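{- Let $(A,\wedge,\vee,\top,\mathsf p,\mathsf q)$ be a $d\ell\mathsf{pq}$-algebra and define $x\cdot y=(\mathsf p x\wedge y)\vee(x\wedge\mathsf q y)$ for $x,y\in A$. (1) The operation $\cdot$ is commutative if and only if $\mathsf p=\mathsf q$. (2) If $\mathsf p=\mathsf q$, then $\cdot$ is associative if and only if $\mathsf p((\mathsf p x\wedge y)\vee(x\wedge\mathsf p y))=(\mathsf p x\wedge\mathsf p y)\vee(x\wedge\mathsf p\mathsf p y)$ for all $x,y\in A$. (3) The operation $\cdot$ is idempotent if and only if $\mathsf p$ and $\mathsf q$ are inflationary, if and only if $\mathsf p\top=\top=\mathsf q\top$. (4) If $\cdot$ is idempotent, then it is associative if and only if for all $x,y\in A$ $$\mathsf p((\mathsf p x\wedge y)\vee(x\wedge\mathsf q y))=(\mathsf p x\wedge\mathsf p y)\vee(x\wedge\mathsf q y)\quad\text{and}\quad \mathsf q((\mathsf p x\wedge y)\vee(x\wedge\mathsf q y))=(\mathsf p x\wedge y)\vee(\mathsf q x\wedge\mathsf q y).$$ (5) An element $1\in A$ is an identity element for $\cdot$ if and only if $\mathsf p1=\top=\mathsf q1$ and $(\mathsf p x\vee\mathsf q x)\wedge1\le x$ for all $x\in A$. (6) If $\cdot$ has an identity element, then $\cdot$ is idempotent.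
   Context: A unary operator on a lattice is a unary operation $f$ with $f(x\vee y)=fx\vee fy$ for all $x,y$. A $d\ell\mathsf{pq}$-algebra is a distributive lattice with top element $\top$ and two unary operators $\mathsf p,\mathsf q$ satisfying, for all $x$, $x\wedge\mathsf p\top\le\mathsf q x$ and $x\wedge\mathsf q\top\le\mathsf p x$. A unary operation $f$ is inflationary if $x\le fx$ for all $x$. The operation $\cdot$ is idempotent if $x\cdot x=x$ for all $x$. An identity element is an element $1$ with $x\cdot 1=x=1\cdot x$ for all $x$. Here $\mathsf p x$ denotes $\mathsf p(x)$, and unary operations bind more strongly than $\cdot,\wedge,\vee$. -}

module Defs where

open import Level using (Level; _⊔_) renaming (suc to lsuc)
open import Algebra.Core using (Op₁; Op₂)
open import Algebra.Definitions using (Congruent₁)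
open import Algebra.Lattice.Bundles using (Lattice; DistributiveLattice)
import Algebra.Lattice.Properties.Lattice as LatticeProperties
open import Relation.Binary.Bundles using (Poset)
open import Relation.Binary.Core using (Rel)
open import Relation.Binary.Definitions using (Maximum)

-- Equality is the setoid equality _≈_ of the lattice, so an operation has to
-- be assumed to respect it.  Preservation of ⊥ is not required (there need
-- not be a ⊥).
record IsUnaryOperator {c ℓ} (L : Lattice c ℓ) (f : Op₁ (Lattice.Carrier L)) :
                       Set (c ⊔ ℓ) where
  open Lattice L using (_≈_; _∨_)
  field
    cong   : Congruent₁ _≈_ f
    homo-∨ : ∀ x y → f (x ∨ y) ≈ (f x ∨ f y)

Inflationary : ∀ {c ℓ} {A : Set c} → Rel A ℓ → Op₁ A → Set (c ⊔ ℓ)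
Inflationary _≤_ f = ∀ x → x ≤ f x

record DℓpqAlgebra (c ℓ : Level) : Set (lsuc (c ⊔ ℓ)) where
  infixr 7 _·_
  field
    distributiveLattice : DistributiveLattice c ℓ

  open DistributiveLattice distributiveLattice public

  -- x ≤ y is x ≈ x ∧ y.
  open Poset (LatticeProperties.poset lattice) public using (_≤_)

  field
    ⊤            : Carrier
    p q          : Op₁ Carrier
    ⊤-maximum    : Maximum _≤_ ⊤
    p-isOperator : IsUnaryOperator lattice p
    q-isOperator : IsUnaryOperator lattice q
    x∧p⊤≤qx      : ∀ x → (x ∧ p ⊤) ≤ q x
    x∧q⊤≤px      : ∀ x → (x ∧ q ⊤) ≤ p x

  _·_ : Op₂ Carrier
  x · y = (p x ∧ y) ∨ (x ∧ q y)

{-# OPTIONS --safe #-}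
-- The operators are recovered from the product as p x = x · ⊤ and
-- q x = ⊤ · x, so each property of · is tested on products involving ⊤.
-- The one less direct step is in (4): associativity and idempotence give
-- p (q y) = ⊤ · y · ⊤ = (⊤ · y) · (y · ⊤) = q y · p y, which lies below
-- p y ∨ q y.
module Submission where

open import Defs
open import Algebra.Definitions using (Associative; Commutative; Idempotent; Identity)
open import Algebra.Lattice.Bundles using (Lattice)
import Algebra.Lattice.Properties.Lattice as LatticeProperties
open import Data.Product.Base using (_×_; ∃-syntax; _,_; proj₁; proj₂)
open import Function.Base using (_∘_)
open import Function.Bundles using (_⇔_; mk⇔)
import Relation.Binary.Lattice as OrderLattice
import Relation.Binary.Lattice.Properties.JoinSemilattice as JoinProperties
import Relation.Binary.Lattice.Properties.MeetSemilattice as MeetProperties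
import Relation.Binary.Reasoning.PartialOrder as PosetReasoning
import Relation.Binary.Reasoning.Setoid as SetoidReasoning

-- Lattice order and monotonicity of operators.

module LatticeOrder {c ℓ} (L : Lattice c ℓ) where

  open LatticeProperties L using (∨-∧-orderTheoreticLattice)
  open OrderLattice.Lattice ∨-∧-orderTheoreticLattice public
    using (_≤_; poset; antisym; x∧y≤x; x∧y≤y; ∧-greatest; x≤x∨y; y≤x∨y; ∨-least)
    renaming (refl to ≤-refl; reflexive to ≤-reflexive; trans to ≤-trans)
  open MeetProperties (OrderLattice.Lattice.meetSemilattice ∨-∧-orderTheoreticLattice) public
    using (∧-monotonic)
  open JoinProperties (OrderLattice.Lattice.joinSemilattice ∨-∧-orderTheoreticLattice) public
    using (∨-monotonic)

  open Lattice L

  operator-mono : ∀ {f} → IsUnaryOperator L f → ∀ {x y} → x ≤ y → f x ≤ f y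
  operator-mono {f} f-op {x} {y} x≤y = begin
    f x        ≤⟨ x≤x∨y (f x) (f y) ⟩
    f x ∨ f y  ≈⟨ homo-∨ x y ⟨
    f (x ∨ y)  ≈⟨ cong (antisym (∨-least x≤y ≤-refl) (y≤x∨y x y)) ⟩
    f y        ∎
    where
    open IsUnaryOperator f-op
    open PosetReasoning poset

-- Bounds for products and recovery of the operators.

module DℓpqProperties {c ℓ} (A : DℓpqAlgebra c ℓ) where

  open DℓpqAlgebra A
  open LatticeOrder lattice hiding (_≤_)

  open IsUnaryOperator p-isOperator public using () renaming (cong to p-cong)
  open IsUnaryOperator q-isOperator public using () renaming (cong to q-cong)

  p-mono : ∀ {x y} → x ≤ y → p x ≤ p y
  p-mono = operator-mono p-isOperator

  q-mono : ∀ {x y} → x ≤ y → q x ≤ q y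
  q-mono = operator-mono q-isOperator

  -- Turns an axiom such as `x ∧ q ⊤ ≤ p x` into `x ≤ p x` once `q ⊤` is known to be the top.
  ≤-∧⊤ : ∀ {x t} → t ≈ ⊤ → x ≤ (x ∧ t)
  ≤-∧⊤ t≈⊤ = ∧-greatest ≤-refl (≤-trans (⊤-maximum _) (≤-reflexive (sym t≈⊤)))

  -- Here and in `∧∨-least` distributivity enters: bounds on nested products reduce to bounds on
  -- their joinands.
  ∨∧-least : ∀ {x y z w} → (x ∧ z) ≤ w → (y ∧ z) ≤ w → ((x ∨ y) ∧ z) ≤ w
  ∨∧-least {x} {y} {z} xz≤w yz≤w =
    ≤-trans (≤-reflexive (∧-distribʳ-∨ z x y)) (∨-least xz≤w yz≤w)

  ∧∨-least : ∀ {x y z w} → (z ∧ x) ≤ w → (z ∧ y) ≤ w → (z ∧ (x ∨ y)) ≤ w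
  ∧∨-least {x} {y} {z} zx≤w zy≤w =
    ≤-trans (≤-reflexive (∧-distribˡ-∨ z x y)) (∨-least zx≤w zy≤w)

  ·-cong : ∀ {x y u v} → x ≈ y → u ≈ v → x · u ≈ y · v
  ·-cong x≈y u≈v = ∨-cong (∧-cong (p-cong x≈y) u≈v) (∧-cong x≈y (q-cong u≈v))

  ·-congˡ : ∀ {x u v} → u ≈ v → x · u ≈ x · v
  ·-congˡ = ·-cong refl

  ·-congʳ : ∀ {x y u} → x ≈ y → x · u ≈ y · u
  ·-congʳ x≈y = ·-cong x≈y refl

  ≤·ˡ : ∀ {x y z} → z ≤ p x → z ≤ y → z ≤ (x · y)
  ≤·ˡ z≤px z≤y = ≤-trans (∧-greatest z≤px z≤y) (x≤x∨y _ _)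

  ≤·ʳ : ∀ {x y z} → z ≤ x → z ≤ q y → z ≤ (x · y)
  ≤·ʳ z≤x z≤qy = ≤-trans (∧-greatest z≤x z≤qy) (y≤x∨y _ _)

  -- The joinand `p x ∧ ⊤` is `p x`, and the axiom `x ∧ q ⊤ ≤ p x` absorbs the other one.
  x·⊤≈px : ∀ x → x · ⊤ ≈ p x
  x·⊤≈px x = antisym (∨-least (x∧y≤x _ _) (x∧q⊤≤px x)) (≤·ˡ ≤-refl (⊤-maximum _))

  ⊤·x≈qx : ∀ x → ⊤ · x ≈ q x
  ⊤·x≈qx x = antisym
    (∨-least (≤-trans (≤-reflexive (∧-comm _ _)) (x∧p⊤≤qx x)) (x∧y≤y _ _))
    (≤·ʳ (⊤-maximum _) ≤-refl)

  -- Commutativity, and associativity tested at the top.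

  comm⇒p≈q : Commutative _≈_ _·_ → ∀ x → p x ≈ q x
  comm⇒p≈q comm x = trans (sym (x·⊤≈px x)) (trans (comm x ⊤) (⊤·x≈qx x))

  p≈q⇒comm : (∀ x → p x ≈ q x) → Commutative _≈_ _·_
  p≈q⇒comm p≈q x y = trans (∨-comm _ _) (∨-cong
    (trans (∧-comm _ _) (∧-congʳ (sym (p≈q y))))
    (trans (∧-comm _ _) (∧-congˡ (p≈q x))))

  assoc⇒p[x·y]≈x·py : Associative _≈_ _·_ → ∀ x y → p (x · y) ≈ x · p y
  assoc⇒p[x·y]≈x·py assoc x y = begin
    p (x · y)    ≈⟨ x·⊤≈px (x · y) ⟨
    (x · y) · ⊤  ≈⟨ assoc x y ⊤ ⟩
    x · (y · ⊤)  ≈⟨ ·-congˡ (x·⊤≈px y) ⟩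
    x · p y      ∎
    where open SetoidReasoning setoid

  assoc⇒q[x·y]≈qx·y : Associative _≈_ _·_ → ∀ x y → q (x · y) ≈ q x · y
  assoc⇒q[x·y]≈qx·y assoc x y = begin
    q (x · y)    ≈⟨ ⊤·x≈qx (x · y) ⟨
    ⊤ · (x · y)  ≈⟨ assoc ⊤ x y ⟨
    (⊤ · x) · y  ≈⟨ ·-congʳ (⊤·x≈qx x) ⟩
    q x · y      ∎
    where open SetoidReasoning setoid

  -- Associativity when the operators coincide.

  module Equal (p≈q : ∀ x → p x ≈ q x) where

    ·-comm : Commutative _≈_ _·_
    ·-comm = p≈q⇒comm p≈q

    x·y≈px∧y∨x∧py : ∀ x y → x · y ≈ (p x ∧ y) ∨ (x ∧ p y)
    x·y≈px∧y∨x∧py x y = ∨-congˡ (∧-congˡ (sym (p≈q y)))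

    assoc⇒pTerm : Associative _≈_ _·_ → ∀ x y →
      p ((p x ∧ y) ∨ (x ∧ p y)) ≈ (p x ∧ p y) ∨ (x ∧ p (p y))
    assoc⇒pTerm assoc x y = begin
      p ((p x ∧ y) ∨ (x ∧ p y))      ≈⟨ p-cong (x·y≈px∧y∨x∧py x y) ⟨
      p (x · y)                      ≈⟨ assoc⇒p[x·y]≈x·py assoc x y ⟩
      x · p y                        ≈⟨ x·y≈px∧y∨x∧py x (p y) ⟩
      (p x ∧ p y) ∨ (x ∧ p (p y))    ∎
      where open SetoidReasoning setoid

    module _ (pTerm : ∀ x y →
      p ((p x ∧ y) ∨ (x ∧ p y)) ≈ (p x ∧ p y) ∨ (x ∧ p (p y))) where

      p[x·y] : ∀ x y → p (x · y) ≈ (p x ∧ p y) ∨ (x ∧ p (p y))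
      p[x·y] x y = trans (p-cong (x·y≈px∧y∨x∧py x y)) (pTerm x y)

      -- Commutativity turns `q (x · y)` into `p (y · x)`, so the term identity applies with its
      -- arguments swapped.
      q[x·y] : ∀ x y → q (x · y) ≈ (p y ∧ p x) ∨ (y ∧ p (p x))
      q[x·y] x y = trans (sym (p≈q _)) (trans (p-cong (·-comm x y)) (p[x·y] y x))

      -- Expanding `p (x · y)` and distributing leaves the joinands `p x ∧ p y ∧ z`,
      -- `x ∧ p (p y) ∧ z`, `p x ∧ y ∧ q z` and `x ∧ q y ∧ q z`. The first and third go into
      -- `p x ∧ (y · z)`, the other two into `x ∧ q (y · z)`.
      [x·y]·z≤x·[y·z] : ∀ x y z → ((x · y) · z) ≤ (x · (y · z))
      [x·y]·z≤x·[y·z] x y z = ∨-least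
        (≤-trans (∧-monotonic (≤-reflexive (p[x·y] x y)) ≤-refl) (∨∧-least
          (≤·ˡ (≤-trans (x∧y≤x _ _) (x∧y≤x _ _))
               (≤·ˡ (≤-trans (x∧y≤x _ _) (x∧y≤y _ _)) (x∧y≤y _ _)))
          (≤·ʳ (≤-trans (x∧y≤x _ _) (x∧y≤x _ _))
               (≤q[y·z] (≤-trans (∧-greatest (x∧y≤y _ _) (≤-trans (x∧y≤x _ _) (x∧y≤y _ _)))
                                 (y≤x∨y _ _))))))
        (∨∧-least
          (≤·ˡ (≤-trans (x∧y≤x _ _) (x∧y≤x _ _))
               (≤·ʳ (≤-trans (x∧y≤x _ _) (x∧y≤y _ _)) (x∧y≤y _ _)))
          (≤·ʳ (≤-trans (x∧y≤x _ _) (x∧y≤x _ _))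
               (≤q[y·z] (≤-trans (∧-monotonic (x∧y≤y _ _) ≤-refl) (≤-trans
                 (≤-reflexive (trans (∧-comm _ _) (∧-cong (sym (p≈q z)) (sym (p≈q y)))))
                 (x≤x∨y _ _))))))
        where
        ≤q[y·z] : ∀ {w} → w ≤ ((p z ∧ p y) ∨ (z ∧ p (p y))) → w ≤ q (y · z)
        ≤q[y·z] w≤ = ≤-trans w≤ (≤-reflexive (sym (q[x·y] y z)))

      pTerm⇒assoc : Associative _≈_ _·_
      pTerm⇒assoc x y z = antisym ([x·y]·z≤x·[y·z] x y z) (begin
        x · (y · z)  ≈⟨ trans (·-comm _ _) (·-congʳ (·-comm y z)) ⟩
        -- The reverse inequality is the one already proved, read for the reversed triple.
        (z · y) · x  ≤⟨ [x·y]·z≤x·[y·z] z y x ⟩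
        z · (y · x)  ≈⟨ trans (·-comm _ _) (·-congʳ (·-comm y x)) ⟩
        (x · y) · z  ∎)
        where open PosetReasoning poset

  -- Idempotence, inflationarity and fixing the top.

  idem⇒p⊤≈⊤ : Idempotent _≈_ _·_ → p ⊤ ≈ ⊤
  idem⇒p⊤≈⊤ idem = trans (sym (x·⊤≈px ⊤)) (idem ⊤)

  idem⇒q⊤≈⊤ : Idempotent _≈_ _·_ → q ⊤ ≈ ⊤
  idem⇒q⊤≈⊤ idem = trans (sym (⊤·x≈qx ⊤)) (idem ⊤)

  q⊤≈⊤⇒p-inflationary : q ⊤ ≈ ⊤ → Inflationary _≤_ p
  q⊤≈⊤⇒p-inflationary q⊤≈⊤ x = ≤-trans (≤-∧⊤ q⊤≈⊤) (x∧q⊤≤px x)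

  p⊤≈⊤⇒q-inflationary : p ⊤ ≈ ⊤ → Inflationary _≤_ q
  p⊤≈⊤⇒q-inflationary p⊤≈⊤ x = ≤-trans (≤-∧⊤ p⊤≈⊤) (x∧p⊤≤qx x)

  inflationary⇒⊤-fixed : ∀ {f} → Inflationary _≤_ f → f ⊤ ≈ ⊤
  inflationary⇒⊤-fixed infl = antisym (⊤-maximum _) (infl ⊤)

  -- Both joinands of `x · x` are meets with `x`, so only `x ≤ x · x` is at stake, and `p x ∧ x`
  -- already provides it.
  inflationary⇒idem : Inflationary _≤_ p → Idempotent _≈_ _·_
  inflationary⇒idem p-infl x = antisym
    (∨-least (x∧y≤y _ _) (x∧y≤x _ _))
    (≤·ˡ (p-infl x) ≤-refl)

  -- Associativity of an idempotent product.

  module Idem (idem : Idempotent _≈_ _·_) where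

    p-infl : Inflationary _≤_ p
    p-infl = q⊤≈⊤⇒p-inflationary (idem⇒q⊤≈⊤ idem)

    q-infl : Inflationary _≤_ q
    q-infl = p⊤≈⊤⇒q-inflationary (idem⇒p⊤≈⊤ idem)

    module _ (assoc : Associative _≈_ _·_) where

      -- Both sides are the triple product of `⊤`, `y` and `⊤`.
      qp≈pq : ∀ y → q (p y) ≈ p (q y)
      qp≈pq y = begin
        q (p y)      ≈⟨ q-cong (x·⊤≈px y) ⟨
        q (y · ⊤)    ≈⟨ assoc⇒q[x·y]≈qx·y assoc y ⊤ ⟩
        q y · ⊤      ≈⟨ x·⊤≈px (q y) ⟩
        p (q y)      ∎
        where open SetoidReasoning setoid

      -- Serves to replace the composites `q (p y)` in `x · p y` and `p (q x)` in `q x · y` by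
      -- single operators.
      pq≤p∨q : ∀ y → p (q y) ≤ (p y ∨ q y)
      pq≤p∨q y = begin
        p (q y)        ≈⟨ p-cong (q-cong (idem y)) ⟨
        p (q (y · y))  ≈⟨ p-cong (assoc⇒q[x·y]≈qx·y assoc y y) ⟩
        p (q y · y)    ≈⟨ assoc⇒p[x·y]≈x·py assoc (q y) y ⟩
        -- The joinands are `p (q y) ∧ p y` and `q y ∧ q (p y)`; each keeps the factor with a single
        -- operator.
        q y · p y      ≤⟨ ∨-monotonic (x∧y≤y _ _) (x∧y≤x _ _) ⟩
        p y ∨ q y      ∎
        where open PosetReasoning poset

      assoc⇒p[x·y] : ∀ x y → p (x · y) ≈ (p x ∧ p y) ∨ (x ∧ q y)
      assoc⇒p[x·y] x y = trans (assoc⇒p[x·y]≈x·py assoc x y) (antisym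
        (∨-least (x≤x∨y _ _)
          -- `x ∧ q (p y)` lies below `(x ∧ p y) ∨ (x ∧ q y)`, and `x ≤ p x` moves the first part
          -- into `p x ∧ p y`.
          (≤-trans (∧-monotonic ≤-refl (≤-trans (≤-reflexive (qp≈pq y)) (pq≤p∨q y)))
            (∧∨-least (≤-trans (∧-monotonic (p-infl x) ≤-refl) (x≤x∨y _ _)) (y≤x∨y _ _))))
        (∨-monotonic ≤-refl (∧-monotonic ≤-refl (q-mono (p-infl y)))))

      assoc⇒q[x·y] : ∀ x y → q (x · y) ≈ (p x ∧ y) ∨ (q x ∧ q y)
      assoc⇒q[x·y] x y = trans (assoc⇒q[x·y]≈qx·y assoc x y) (antisym
        (∨-least
          (≤-trans (∧-monotonic (pq≤p∨q x) ≤-refl)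
            (∨∧-least (x≤x∨y _ _) (≤-trans (∧-monotonic ≤-refl (q-infl y)) (y≤x∨y _ _))))
          (y≤x∨y _ _))
        (∨-monotonic (∧-monotonic (p-mono (q-infl x)) ≤-refl) ≤-refl))

    module _
      (p[x·y] : ∀ x y → p (x · y) ≈ (p x ∧ p y) ∨ (x ∧ q y))
      (q[x·y] : ∀ x y → q (x · y) ≈ (p x ∧ y) ∨ (q x ∧ q y))
      where

      ≤p· : ∀ {x y z} → z ≤ ((p x ∧ p y) ∨ (x ∧ q y)) → z ≤ p (x · y)
      ≤p· z≤ = ≤-trans z≤ (≤-reflexive (sym (p[x·y] _ _)))

      ≤q· : ∀ {x y z} → z ≤ ((p x ∧ y) ∨ (q x ∧ q y)) → z ≤ q (x · y)
      ≤q· z≤ = ≤-trans z≤ (≤-reflexive (sym (q[x·y] _ _)))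

      -- Both bracketings reduce to the join of `p x ∧ p y ∧ z`, `p x ∧ y ∧ q z` and
      -- `x ∧ q y ∧ q z`. The left one has the extra joinand `x ∧ q y ∧ z`, absorbed because
      -- `z ≤ q z`; the right one has `x ∧ p y ∧ z`, absorbed because `x ≤ p x`.
      pqTerms⇒assoc : Associative _≈_ _·_
      pqTerms⇒assoc x y z = antisym
        (∨-least
          (≤-trans (∧-monotonic (≤-reflexive (p[x·y] x y)) ≤-refl) (∨∧-least
            (≤·ˡ (≤-trans (x∧y≤x _ _) (x∧y≤x _ _))
                 (≤·ˡ (≤-trans (x∧y≤x _ _) (x∧y≤y _ _)) (x∧y≤y _ _)))
            (≤-trans (∧-monotonic ≤-refl (q-infl z)) x∧qy∧qz≤)))
          (∨∧-least
            (≤·ˡ (≤-trans (x∧y≤x _ _) (x∧y≤x _ _))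
                 (≤·ʳ (≤-trans (x∧y≤x _ _) (x∧y≤y _ _)) (x∧y≤y _ _)))
            x∧qy∧qz≤))
        (∨-least
          (∧∨-least
            px∧py∧z≤
            (≤·ʳ (≤·ˡ (x∧y≤x _ _) (≤-trans (x∧y≤y _ _) (x∧y≤x _ _)))
                 (≤-trans (x∧y≤y _ _) (x∧y≤y _ _))))
          (≤-trans (∧-monotonic ≤-refl (≤-reflexive (q[x·y] y z))) (∧∨-least
            (≤-trans (∧-monotonic (p-infl x) ≤-refl) px∧py∧z≤)
            (≤·ʳ (≤·ʳ (x∧y≤x _ _) (≤-trans (x∧y≤y _ _) (x∧y≤x _ _)))
                 (≤-trans (x∧y≤y _ _) (x∧y≤y _ _))))))
        where
        x∧qy∧qz≤ : ((x ∧ q y) ∧ q z) ≤ (x · (y · z))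
        x∧qy∧qz≤ = ≤·ʳ (≤-trans (x∧y≤x _ _) (x∧y≤x _ _))
          (≤q· (≤-trans (∧-monotonic (x∧y≤y _ _) ≤-refl) (y≤x∨y _ _)))

        px∧py∧z≤ : (p x ∧ (p y ∧ z)) ≤ ((x · y) · z)
        px∧py∧z≤ = ≤·ˡ
          (≤p· (≤-trans (∧-monotonic ≤-refl (x∧y≤x _ _)) (x≤x∨y _ _)))
          (≤-trans (x∧y≤y _ _) (x∧y≤y _ _))

  -- Identity elements.

  module Unit {𝟙} (identity : Identity _≈_ 𝟙 _·_) where

    p𝟙≈⊤ : p 𝟙 ≈ ⊤
    p𝟙≈⊤ = trans (sym (x·⊤≈px 𝟙)) (proj₁ identity ⊤)

    q𝟙≈⊤ : q 𝟙 ≈ ⊤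
    q𝟙≈⊤ = trans (sym (⊤·x≈qx 𝟙)) (proj₂ identity ⊤)

    -- `p x ∧ 𝟙` is a joinand of `x · 𝟙` and `𝟙 ∧ q x` one of `𝟙 · x`; both products equal `x`.
    [px∨qx]∧𝟙≤x : ∀ x → ((p x ∨ q x) ∧ 𝟙) ≤ x
    [px∨qx]∧𝟙≤x x = ∨∧-least
      (≤-trans (x≤x∨y _ _) (≤-reflexive (proj₂ identity x)))
      (≤-trans (≤-reflexive (∧-comm _ _))
        (≤-trans (y≤x∨y _ _) (≤-reflexive (proj₁ identity x))))

    -- Monotonicity lifts `q 𝟙 ≈ ⊤` to `q ⊤ ≈ ⊤`, which makes `p` inflationary.
    identity⇒idem : Idempotent _≈_ _·_
    identity⇒idem = inflationary⇒idem (q⊤≈⊤⇒p-inflationary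
      (antisym (⊤-maximum _)
        (≤-trans (≤-reflexive (sym q𝟙≈⊤)) (q-mono (⊤-maximum 𝟙)))))

  -- With `p 𝟙` and `q 𝟙` at the top, one joinand of each product is `x` itself, and the bound puts
  -- the other below `x`.
  mkIdentity : ∀ {𝟙} → p 𝟙 ≈ ⊤ → q 𝟙 ≈ ⊤ → (∀ x → ((p x ∨ q x) ∧ 𝟙) ≤ x) →
               Identity _≈_ 𝟙 _·_
  mkIdentity p𝟙≈⊤ q𝟙≈⊤ bound =
    (λ x → antisym
      (∨-least (x∧y≤y _ _)
        (≤-trans (≤-reflexive (∧-comm _ _))
          (≤-trans (∧-monotonic (y≤x∨y _ _) ≤-refl) (bound x))))
      (≤-trans (≤-∧⊤ p𝟙≈⊤) (≤-trans (≤-reflexive (∧-comm _ _)) (x≤x∨y _ _)))) ,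
    (λ x → antisym
      (∨-least (≤-trans (∧-monotonic (x≤x∨y _ _) ≤-refl) (bound x)) (x∧y≤x _ _))
      (≤-trans (≤-∧⊤ q𝟙≈⊤) (y≤x∨y _ _)))

lemma2p2 : ∀ {c ℓ} (A : DℓpqAlgebra c ℓ) → let open DℓpqAlgebra A in
    -- (1)
    (Commutative _≈_ _·_ ⇔ (∀ x → p x ≈ q x))
    -- (2)
  × ((∀ x → p x ≈ q x) →
      (Associative _≈_ _·_ ⇔
        (∀ x y → p ((p x ∧ y) ∨ (x ∧ p y)) ≈ ((p x ∧ p y) ∨ (x ∧ p (p y))))))
    -- (3)
  × ((Idempotent _≈_ _·_ ⇔ (Inflationary _≤_ p × Inflationary _≤_ q))
    × ((Inflationary _≤_ p × Inflationary _≤_ q) ⇔ ((p ⊤ ≈ ⊤) × (⊤ ≈ q ⊤))))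
    -- (4)
  × (Idempotent _≈_ _·_ →
      (Associative _≈_ _·_ ⇔
        (∀ x y →
          (p ((p x ∧ y) ∨ (x ∧ q y)) ≈ ((p x ∧ p y) ∨ (x ∧ q y)))
          × (q ((p x ∧ y) ∨ (x ∧ q y)) ≈ ((p x ∧ y) ∨ (q x ∧ q y))))))
    -- (5)
  × (∀ 𝟙 →
      (Identity _≈_ 𝟙 _·_ ⇔
        (((p 𝟙 ≈ ⊤) × (⊤ ≈ q 𝟙)) × (∀ x → ((p x ∨ q x) ∧ 𝟙) ≤ x))))
    -- (6)
  × ((∃[ 𝟙 ] Identity _≈_ 𝟙 _·_) → Idempotent _≈_ _·_)
lemma2p2 A =
    mk⇔ comm⇒p≈q p≈q⇒comm
  , (λ p≈q → mk⇔ (Equal.assoc⇒pTerm p≈q) (Equal.pTerm⇒assoc p≈q))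
  , ( mk⇔ (λ idem → Idem.p-infl idem , Idem.q-infl idem) (inflationary⇒idem ∘ proj₁)
    , mk⇔ (λ (p-infl , q-infl) →
             inflationary⇒⊤-fixed p-infl , sym (inflationary⇒⊤-fixed q-infl))
          (λ (p⊤≈⊤ , ⊤≈q⊤) →
             q⊤≈⊤⇒p-inflationary (sym ⊤≈q⊤) , p⊤≈⊤⇒q-inflationary p⊤≈⊤))
  , (λ idem → mk⇔
      (λ assoc x y → Idem.assoc⇒p[x·y] idem assoc x y , Idem.assoc⇒q[x·y] idem assoc x y)
      (λ pqTerms → Idem.pqTerms⇒assoc idem
        (λ x y → proj₁ (pqTerms x y)) (λ x y → proj₂ (pqTerms x y))))
  , (λ 𝟙 → mk⇔
      (λ identity →
        (Unit.p𝟙≈⊤ identity , sym (Unit.q𝟙≈⊤ identity)) , Unit.[px∨qx]∧𝟙≤x identity)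
      (λ ((p𝟙≈⊤ , ⊤≈q𝟙) , bound) → mkIdentity p𝟙≈⊤ (sym ⊤≈q𝟙) bound))
  , (λ (_ , identity) → Unit.identity⇒idem identity)
  where
  open DℓpqAlgebra A using (sym)
  open DℓpqProperties A
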